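{- Let $(G,C)$ be a C-group. There exists a valuation $v:G\to\Gamma\cup\{\infty\}$ with value set $\Gamma\cup\{\infty\}$ such that the following holds: 1. For any $\gamma\in\Gamma$, $C$ induces a (compatible) C-relation $C_{\gamma}$ on the quotient $G^{\gamma}/G_{\gamma}$ defined, for $f,g,h\in G^\gamma$, by the formula $$C_{\gamma}(fG_{\gamma},gG_{\gamma},hG_{\gamma})\Leftrightarrow fh^{ -1}\notin G_{\gamma}\wedge\big(gh^{ -1}\in G_{\gamma}\vee C(f,g,h)\big).$$ 2. For each $\gamma\in\Gamma$, $C_{\gamma}$ is of elementary type. 3. If $\gamma<\delta$ are elements of $\Gamma$ such that $C_{\gamma}$ and $C_{\delta}$ are both valuational, then there exists $\alpha\in\Gamma$ between $\gamma$ and $\delta$ such that $C_{\alpha}$ is order-type.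
   Context: A C-relation on a set is a ternary relation $C$ such that for all $x,y,z,w$: $C(x,y,z)\Rightarrow C(x,z,y)$; $C(x,y,z)\Rightarrow\neg C(y,x,z)$; $C(x,y,z)\Rightarrow C(w,y,z)\vee C(x,w,z)$; $x\neq y\Rightarrow C(x,y,y)$. A C-relation on a group is compatible if $C(x,y,z)$ implies $C(vxu,vyu,vzu)$ for all $x,y,z,u,v$. A C-group is a group with a compatible C-relation. With $g^z:=zgz^{ -1}$, a valuation on a group $G$ is a map $v:G\to\Gamma\cup\{\infty\}$, where $\Gamma$ is totally ordered and $\gamma<\infty$ for all $\gamma\in\Gamma$, such that for all $g,h,z$: $v(g)=\infty\Leftrightarrow g=1$; $v(gh^{ -1})\geq\min(v(g),v(h))$; $v(g)\leq v(h)\Leftrightarrow v(g^z)\leq v(h^z)$. Put $G^{\gamma}=\{g\in G\mid v(g)\geq\gamma\}$ and $G_{\gamma}=\{g\in G\mid v(g)>\gamma\}$; these are subgroups of $G$ and $G_\gamma$ is normal in $G^\gamma$. A compatible C-relation on a group is order-type if it is of the form $C(x,y,z)\Leftrightarrow(y<x\wedge z<x)\vee(y=z\neq x)$ for a total order $\leq$ making the group a (bi-)ordered group, i.e. $x\leq y$ implies $xz\leq yz$ and $zx\leq zy$. It is valuational if it is of the form $C(x,y,z)\Leftrightarrow v(yz^{ -1})>v(xz^{ -1})$ for a valuation $v$ on the group. It is of elementary type if it is order-type or valuational. -}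

module Defs where

open import Level using (Level; _⊔_; suc)
open import Algebra.Bundles using (Group)
import Algebra.Construct.NaturalChoice.Min as Min
import Algebra.Properties.Group as GroupProperties
open import Data.Product.Base using (Σ-syntax; _×_; _,_; proj₁; proj₂)
open import Data.Sum.Base using (_⊎_; inj₁; inj₂)
open import Function.Bundles using (_⇔_; Equivalence)
open import Relation.Binary.Bundles using (TotalOrder)
open import Relation.Binary.Core using (Rel)
open import Relation.Binary.Structures using (IsTotalOrder)
import Relation.Binary.Construct.Add.Supremum.NonStrict as AddSupremum
import Relation.Binary.Construct.NonStrictToStrict as ToStrict
import Relation.Binary.Properties.TotalOrder as TotalOrderProperties
import Relation.Binary.Reasoning.Setoid as SetoidReasoning
open import Relation.Nullary.Construct.Add.Supremum using (_⁺; ⊤⁺; [_])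
open import Relation.Nullary.Negation.Core using (¬_; contradiction)

Rel₃ : ∀ {a} → Set a → (r : Level) → Set (a ⊔ suc r)
Rel₃ A r = A → A → A → Set r

-- Groups are setoid-based, so a relation on a group has to respect _≈_; on a
-- quotient group, C-cong is well-definedness on cosets.
record IsCompatibleCRelation {c ℓ r} (G : Group c ℓ) (C : Rel₃ (Group.Carrier G) r)
       : Set (c ⊔ ℓ ⊔ r) where
  open Group G
  field
    C-cong     : ∀ {x x′ y y′ z z′} → x ≈ x′ → y ≈ y′ → z ≈ z′ →
                 C x y z → C x′ y′ z′
    C-swap     : ∀ {x y z} → C x y z → C x z y
    C-asym     : ∀ {x y z} → C x y z → ¬ C y x z
    C-cotrans  : ∀ {x y z} w → C x y z → C w y z ⊎ C x w z
    C-distinct : ∀ {x y} → ¬ x ≈ y → C x y y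
    compatible : ∀ {x y z} u v → C x y z →
                 C (v ∙ x ∙ u) (v ∙ y ∙ u) (v ∙ z ∙ u)

record CGroup (c ℓ r : Level) : Set (suc (c ⊔ ℓ ⊔ r)) where
  field
    group                 : Group c ℓ
    C                     : Rel₃ (Group.Carrier group) r
    isCompatibleCRelation : IsCompatibleCRelation group C
  open Group group public

-- Γ ∪ {∞}, with ∞ = ⊤⁺
infix 8 _∪∞
_∪∞ : ∀ {a b d} → TotalOrder a b d → TotalOrder a (a ⊔ b) (a ⊔ d)
Γ ∪∞ = record { isTotalOrder = AddSupremum.≤⁺-isTotalOrder _≤_ isTotalOrder }
  where open TotalOrder Γ

module _ {c ℓ} (G : Group c ℓ) where
  open Group G

  infix 9 _^_
  _^_ : Carrier → Carrier → Carrier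
  g ^ z = z ∙ g ∙ z ⁻¹

record Valuation {c ℓ a b d} (G : Group c ℓ) (Γ : TotalOrder a b d)
       : Set (c ⊔ ℓ ⊔ a ⊔ b ⊔ d) where
  private
    module G = Group G
    module Γ = TotalOrder Γ
  open TotalOrder (Γ ∪∞) using (_≈_; _≤_)
  open Min (Γ ∪∞) using (_⊓_)
  open G using (_∙_; _⁻¹; ε)
  field
    v      : G.Carrier → Γ.Carrier ⁺
    v-cong : ∀ {g h} → g G.≈ h → v g ≈ v h
    v-∞    : ∀ g → v g ≈ ⊤⁺ ⇔ g G.≈ ε
    v-min  : ∀ g h → v g ⊓ v h ≤ v (g ∙ h ⁻¹)
    v-conj : ∀ g h z → v g ≤ v h ⇔ v (_^_ G g z) ≤ v (_^_ G h z)

module Subquotient {c ℓ a b d} {G : Group c ℓ} {Γ : TotalOrder a b d}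
                   (V : Valuation G Γ) (γ : TotalOrder.Carrier Γ) where
  open Group G
  open Valuation V
  private
    module ∞ where
      open TotalOrder (Γ ∪∞) public
      open TotalOrderProperties (Γ ∪∞) public
      open Min (Γ ∪∞) public
  open ∞ using (_≤_; _<_; _⊓_)

  infix 4 _∈G^γ _∈Gγ

  _∈G^γ : Carrier → Set (a ⊔ d)
  g ∈G^γ = [ γ ] ≤ v g

  _∈Gγ : Carrier → Set (a ⊔ b ⊔ d)
  g ∈Gγ = [ γ ] < v g

  private
    open GroupProperties G

    <-≤-trans : ∀ {x y z} → x < y → y ≤ z → x < z
    <-≤-trans = ToStrict.<-≤-trans ∞._≈_ _≤_ ∞.Eq.sym ∞.trans ∞.antisym ∞.≤-respʳ-≈

    ≤-respects : ∀ {g h} → g ≈ h → g ∈G^γ → h ∈G^γ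
    ≤-respects g≈h = ∞.≤-respʳ-≈ (v-cong g≈h)

    <-respects : ∀ {g h} → g ≈ h → g ∈Gγ → h ∈Gγ
    <-respects g≈h = ∞.<-respʳ-≈ (v-cong g≈h)

    vε≈∞ : v ε ∞.≈ ⊤⁺
    vε≈∞ = Equivalence.from (v-∞ ε) refl

    ≤-ε : ε ∈G^γ
    ≤-ε = ∞.≤-respʳ-≈ (∞.Eq.sym vε≈∞) ([ γ ] AddSupremum.≤⊤⁺)

    <-ε : ε ∈Gγ
    <-ε = ≤-ε , λ p → absurd (∞.Eq.trans p vε≈∞)
      where
      absurd : ¬ ([ γ ] ∞.≈ ⊤⁺)
      absurd ()

    ≤-div : ∀ {g h} → g ∈G^γ → h ∈G^γ → g ∙ h ⁻¹ ∈G^γ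
    ≤-div {g} {h} p q = ∞.trans (∞.⊓-glb p q) (v-min g h)

    <-div : ∀ {g h} → g ∈Gγ → h ∈Gγ → g ∙ h ⁻¹ ∈Gγ
    <-div {g} {h} p q with ∞.⊓-sel (v g) (v h)
    ... | inj₁ e = <-≤-trans (∞.<-respʳ-≈ (∞.Eq.sym e) p) (v-min g h)
    ... | inj₂ e = <-≤-trans (∞.<-respʳ-≈ (∞.Eq.sym e) q) (v-min g h)

    ≤-inv : ∀ {g} → g ∈G^γ → g ⁻¹ ∈G^γ
    ≤-inv p = ≤-respects (identityˡ _) (≤-div ≤-ε p)

    <-inv : ∀ {g} → g ∈Gγ → g ⁻¹ ∈Gγ
    <-inv p = <-respects (identityˡ _) (<-div <-ε p)

    ≤-mul : ∀ {g h} → g ∈G^γ → h ∈G^γ → g ∙ h ∈G^γ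
    ≤-mul p q = ≤-respects (∙-congˡ (⁻¹-involutive _)) (≤-div p (≤-inv q))

    <-mul : ∀ {g h} → g ∈Gγ → h ∈Gγ → g ∙ h ∈Gγ
    <-mul p q = <-respects (∙-congˡ (⁻¹-involutive _)) (<-div p (<-inv q))

    self-conj : ∀ g → _^_ G g g ≈ g
    self-conj g = trans (assoc g g (g ⁻¹)) (trans (∙-congˡ (inverseʳ g)) (identityʳ g))

    <-normal : ∀ {g} z → z ∈G^γ → g ∈Gγ → _^_ G g z ∈Gγ
    <-normal {g} z z∈ g∈ with ∞.total (v g) (v z)
    ... | inj₁ vg≤vz = <-div (<-mul z∈′ g∈) z∈′
      where z∈′ = <-≤-trans g∈ vg≤vz
    ... | inj₂ vz≤vg =
      ∞.trans z∈ (∞.trans (∞.reflexive (v-cong (sym (self-conj z))))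
                          (Equivalence.to (v-conj z g z) vz≤vg))
      , λ γ≈ →
        let vgᶻ≤vzᶻ = ∞.trans (∞.reflexive (∞.Eq.sym γ≈))
                        (∞.trans z∈ (∞.reflexive (v-cong (sym (self-conj z)))))
            z∈′ = <-≤-trans g∈ (Equivalence.from (v-conj g z z) vgᶻ≤vzᶻ)
        in proj₂ (<-div (<-mul z∈′ g∈) z∈′) γ≈

    ≈⇒∈ : ∀ {g h} → g ≈ h → g ∙ h ⁻¹ ∈Gγ
    ≈⇒∈ g≈h = <-respects (sym (x≈y⇒x∙y⁻¹≈ε g≈h)) <-ε

    cancel-middle : ∀ x y z → (x ∙ y ⁻¹) ∙ (y ∙ z) ≈ x ∙ z
    cancel-middle x y z = trans (assoc x (y ⁻¹) (y ∙ z)) (∙-congˡ (\\-leftDividesʳ y z))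

    sym-∈ : ∀ {f g} → f ∙ g ⁻¹ ∈Gγ → g ∙ f ⁻¹ ∈Gγ
    sym-∈ {f} {g} p = <-respects (⁻¹-anti-homo-// f g) (<-inv p)

    trans-∈ : ∀ {f g h} → f ∙ g ⁻¹ ∈Gγ → g ∙ h ⁻¹ ∈Gγ → f ∙ h ⁻¹ ∈Gγ
    trans-∈ {f} {g} {h} p q = <-respects (cancel-middle f g (h ⁻¹)) (<-mul p q)

    ∙-cong-∈ : ∀ {f f′ g g′} → f ∈G^γ → f ∙ f′ ⁻¹ ∈Gγ → g ∙ g′ ⁻¹ ∈Gγ →
               (f ∙ g) ∙ (f′ ∙ g′) ⁻¹ ∈Gγ
    ∙-cong-∈ {f} {f′} {g} {g′} f∈ p q = <-respects eq (<-mul (<-normal f f∈ q) p)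
      where
      open SetoidReasoning setoid
      eq : (f ∙ (g ∙ g′ ⁻¹) ∙ f ⁻¹) ∙ (f ∙ f′ ⁻¹) ≈ (f ∙ g) ∙ (f′ ∙ g′) ⁻¹
      eq = begin
        (f ∙ (g ∙ g′ ⁻¹) ∙ f ⁻¹) ∙ (f ∙ f′ ⁻¹) ≈⟨ cancel-middle _ f (f′ ⁻¹) ⟩
        f ∙ (g ∙ g′ ⁻¹) ∙ f′ ⁻¹                ≈⟨ ∙-congʳ (assoc f g (g′ ⁻¹)) ⟨
        f ∙ g ∙ g′ ⁻¹ ∙ f′ ⁻¹                  ≈⟨ assoc (f ∙ g) (g′ ⁻¹) (f′ ⁻¹) ⟩
        f ∙ g ∙ (g′ ⁻¹ ∙ f′ ⁻¹)                ≈⟨ ∙-congˡ (⁻¹-anti-homo-∙ f′ g′) ⟨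
        (f ∙ g) ∙ (f′ ∙ g′) ⁻¹                 ∎

    ⁻¹-cong-∈ : ∀ {f g} → f ∈G^γ → f ∙ g ⁻¹ ∈Gγ → f ⁻¹ ∙ (g ⁻¹) ⁻¹ ∈Gγ
    ⁻¹-cong-∈ {f} {g} f∈ p = <-respects eq (<-normal (f ⁻¹) (≤-inv f∈) (sym-∈ p))
      where
      open SetoidReasoning setoid
      eq : f ⁻¹ ∙ (g ∙ f ⁻¹) ∙ (f ⁻¹) ⁻¹ ≈ f ⁻¹ ∙ (g ⁻¹) ⁻¹
      eq = begin
        f ⁻¹ ∙ (g ∙ f ⁻¹) ∙ (f ⁻¹) ⁻¹ ≈⟨ assoc _ _ _ ⟩
        f ⁻¹ ∙ (g ∙ f ⁻¹ ∙ (f ⁻¹) ⁻¹) ≈⟨ ∙-congˡ (//-rightDividesʳ (f ⁻¹) g) ⟩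
        f ⁻¹ ∙ g                      ≈⟨ ∙-congˡ (⁻¹-involutive g) ⟨
        f ⁻¹ ∙ (g ⁻¹) ⁻¹              ∎

  -- G^γ / G_γ: the elements are those of G^γ, and f, h are identified when
  -- f h⁻¹ ∈ G_γ.
  quotient : Group (c ⊔ a ⊔ d) (a ⊔ b ⊔ d)
  quotient = record
    { Carrier = Σ[ g ∈ Carrier ] g ∈G^γ
    ; _≈_     = λ (f , _) (h , _) → f ∙ h ⁻¹ ∈Gγ
    ; _∙_     = λ (f , p) (h , q) → f ∙ h , ≤-mul p q
    ; ε       = ε , ≤-ε
    ; _⁻¹     = λ (f , p) → f ⁻¹ , ≤-inv p
    ; isGroup = record
      { isMonoid = record
        { isSemigroup = record
          { isMagma = record
            { isEquivalence = record
              { refl  = ≈⇒∈ refl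
              ; sym   = sym-∈
              ; trans = trans-∈
              }
            ; ∙-cong = λ {(_ , f∈)} → ∙-cong-∈ f∈
            }
          ; assoc = λ (f , _) (g , _) (h , _) → ≈⇒∈ (assoc f g h)
          }
        ; identity = (λ (f , _) → ≈⇒∈ (identityˡ f)) , (λ (f , _) → ≈⇒∈ (identityʳ f))
        }
      ; inverse = (λ (f , _) → ≈⇒∈ (inverseˡ f)) , (λ (f , _) → ≈⇒∈ (inverseʳ f))
      ; ⁻¹-cong = λ {(_ , f∈)} → ⁻¹-cong-∈ f∈
      }
    }

  induced : ∀ {r} → Rel₃ Carrier r → Rel₃ (Group.Carrier quotient) (a ⊔ b ⊔ d ⊔ r)
  induced C (f , _) (g , _) (h , _) =
    ¬ (f ∙ h ⁻¹ ∈Gγ) × (g ∙ h ⁻¹ ∈Gγ ⊎ C f g h)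

open Subquotient public using (quotient; induced)

record IsBiOrder {c ℓ o} (G : Group c ℓ) (_≤_ : Rel (Group.Carrier G) o)
       : Set (c ⊔ ℓ ⊔ o) where
  open Group G
  field
    isTotalOrder : IsTotalOrder _≈_ _≤_
    mulʳ         : ∀ {x y} z → x ≤ y → (x ∙ z) ≤ (y ∙ z)
    mulˡ         : ∀ {x y} z → x ≤ y → (z ∙ x) ≤ (z ∙ y)

module _ {c ℓ r} (G : Group c ℓ) (C : Rel₃ (Group.Carrier G) r) where
  open Group G

  record OrderType : Set (suc (c ⊔ ℓ ⊔ r)) where
    field
      _≤_       : Rel Carrier (c ⊔ ℓ ⊔ r)
      isBiOrder : IsBiOrder G _≤_
    open ToStrict _≈_ _≤_ using (_<_)
    field
      C⇔        : ∀ x y z → C x y z ⇔ ((y < x × z < x) ⊎ (y ≈ z × ¬ z ≈ x))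

  record Valuational : Set (suc (c ⊔ ℓ ⊔ r)) where
    field
      Γ         : TotalOrder (c ⊔ ℓ ⊔ r) (c ⊔ ℓ ⊔ r) (c ⊔ ℓ ⊔ r)
      valuation : Valuation G Γ
    open Valuation valuation using (v)
    open TotalOrderProperties (Γ ∪∞) using (_<_)
    field
      C⇔        : ∀ x y z → C x y z ⇔ v (x ∙ z ⁻¹) < v (y ∙ z ⁻¹)

  ElementaryType : Set (suc (c ⊔ ℓ ⊔ r))
  ElementaryType = OrderType ⊎ Valuational

{-# OPTIONS --safe #-}
module Submission where

-- Put y ≺ x for C(x,y,1). This is a strict weak order, invariant under
-- conjugation, and it determines C. In the order-type case the negative elements
-- are all equivalent, lie just above 1 and below the positive ones; in the
-- valuational case it is the reversed order of values. In general call k negative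
-- when k ≺ k⁻¹, and attach to it the subgroups
--   U k = {x | x ≼ k or x⁻¹ ≼ k},  S k = {x | x ≼ k and x⁻¹ ≼ k}.
-- That they are subgroups, and that all of them together form a chain, comes from
-- two facts: k ≺ x, x⁻¹ implies k⁻¹ ≺ x, and x⁻¹ ≺ (xy)⁻¹ excludes y ≺ xy. The
-- chain is stable under conjugation, so it defines a valuation. For γ = v(k) with
-- k negative, G^γ / G_γ is U k / S k, in which every nontrivial element is either
-- equivalent to k or the inverse of such an element: C_γ is order-type. If γ is
-- not the value of a negative element, then x ~ x⁻¹ on G^γ / G_γ, which makes C_γ
-- valuational. Distinct values γ < δ are separated by some U k or S k, hence by
-- v(k), and v(k) differs from both when C_γ and C_δ are valuational.

open import Defs
open import Level using (_⊔_; Lift; lift; lower)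
open import Algebra.Bundles using (Group)
import Algebra.Construct.NaturalChoice.Min as Min
import Algebra.Properties.Group as GroupProperties
open import Axiom.DoubleNegationElimination using (DoubleNegationElimination; em⇒dne)
open import Axiom.ExcludedMiddle using (ExcludedMiddle)
open import Data.Product.Base using (Σ-syntax; _×_; _,_; proj₁; proj₂; swap)
open import Data.Sum.Base as Sum using (_⊎_; inj₁; inj₂; [_,_]′)
open import Function.Base using (_∘_; id)
open import Function.Bundles using (_⇔_; mk⇔; Equivalence)
open import Function.Definitions using (Surjective)
open import Relation.Binary.Bundles using (TotalOrder)
open import Relation.Binary.Core using (Rel)
import Relation.Binary.Construct.Add.Supremum.NonStrict as AddSupremum
import Relation.Binary.Properties.TotalOrder as TotalOrderProperties
import Relation.Binary.Construct.Add.Supremum.Equality as SupremumEquality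
open import Relation.Binary.Properties.TotalOrder using (_<_)
open import Relation.Nullary.Construct.Add.Supremum using (_⁺; ⊤⁺; [_])
open import Relation.Nullary.Decidable.Core using (Dec; yes; no)
open import Relation.Nullary.Negation.Core using (¬_; contradiction)

-- Conjugation identities in a group.

module Conjugation {c ℓ} (G : Group c ℓ) where

  open Group G
  open GroupProperties G
  open import Relation.Binary.Reasoning.Setoid setoid

  conj-cong : ∀ {x y} z → x ≈ y → _^_ G x z ≈ _^_ G y z
  conj-cong z x≈y = ∙-congʳ (∙-congˡ x≈y)

  conj-ε : ∀ z → _^_ G ε z ≈ ε
  conj-ε z = trans (∙-congʳ (identityʳ z)) (inverseʳ z)

  conj-⁻¹ : ∀ x z → _^_ G (x ⁻¹) z ≈ (_^_ G x z) ⁻¹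
  conj-⁻¹ x z = sym (begin
    (z ∙ x ∙ z ⁻¹) ⁻¹  ≈⟨ ⁻¹-anti-homo-// (z ∙ x) z ⟩
    z ∙ (z ∙ x) ⁻¹     ≈⟨ ∙-congˡ (⁻¹-anti-homo-∙ z x) ⟩
    z ∙ (x ⁻¹ ∙ z ⁻¹)  ≈⟨ assoc _ _ _ ⟨
    z ∙ x ⁻¹ ∙ z ⁻¹    ∎)

  conj⁻¹-conj : ∀ x z → _^_ G (_^_ G x z) (z ⁻¹) ≈ x
  conj⁻¹-conj x z = begin
    z ⁻¹ ∙ (z ∙ x ∙ z ⁻¹) ∙ z ⁻¹ ⁻¹  ≈⟨ ∙-congʳ (assoc _ _ _) ⟨
    z ⁻¹ ∙ (z ∙ x) ∙ z ⁻¹ ∙ z ⁻¹ ⁻¹  ≈⟨ //-rightDividesʳ (z ⁻¹) _ ⟩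
    z ⁻¹ ∙ (z ∙ x)                   ≈⟨ \\-leftDividesʳ z x ⟩
    x                                ∎

  conj-conj⁻¹ : ∀ x z → _^_ G (_^_ G x (z ⁻¹)) z ≈ x
  conj-conj⁻¹ x z = begin
    z ∙ (z ⁻¹ ∙ x ∙ z ⁻¹ ⁻¹) ∙ z ⁻¹  ≈⟨ ∙-congʳ (assoc _ _ _) ⟨
    z ∙ (z ⁻¹ ∙ x) ∙ z ⁻¹ ⁻¹ ∙ z ⁻¹  ≈⟨ //-rightDividesˡ (z ⁻¹) _ ⟩
    z ∙ (z ⁻¹ ∙ x)                   ≈⟨ \\-leftDividesˡ z x ⟩
    x                                ∎

-- Valuations encoded as preorders, `x ⊴ y` standing for v(x) ≥ v(y).

record IsValuationPreorder {c ℓ p} (G : Group c ℓ) (_⊴_ : Rel (Group.Carrier G) p)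
       : Set (c ⊔ ℓ ⊔ p) where
  open Group G
  field
    ⊴-reflexive : ∀ {x y} → x ≈ y → x ⊴ y
    ⊴-trans     : ∀ {x y z} → x ⊴ y → y ⊴ z → x ⊴ z
    ⊴-total     : ∀ x y → x ⊴ y ⊎ y ⊴ x
    ε-min       : ∀ x → ε ⊴ x
    ⊴ε⇒≈ε       : ∀ {x} → x ⊴ ε → x ≈ ε
    ⊴-div       : ∀ {x y z} → x ⊴ z → y ⊴ z → (x ∙ y ⁻¹) ⊴ z
    ⊴-conj      : ∀ {x y} z → x ⊴ y → _^_ G x z ⊴ _^_ G y z

module PreorderValuation (em : ∀ {a} → ExcludedMiddle a)
  {c ℓ p} {G : Group c ℓ} {_⊴_ : Rel (Group.Carrier G) p}
  (isValuationPreorder : IsValuationPreorder G _⊴_) where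

  open Group G
  open IsValuationPreorder isValuationPreorder
  open Conjugation G

  -- Nontrivial elements serve as their own values: mutual `⊴` is the setoid equality, which
  -- replaces the passage to classes. `Lift` only adjusts the universe level.
  Γ : TotalOrder (c ⊔ ℓ ⊔ p) p p
  Γ = record
    { Carrier = Σ[ x ∈ Carrier ] Lift p (¬ x ≈ ε)
    ; _≈_     = λ (x , _) (y , _) → x ⊴ y × y ⊴ x
    ; _≤_     = λ (x , _) (y , _) → y ⊴ x
    ; isTotalOrder = record
      { isPartialOrder = record
        { isPreorder = record
          { isEquivalence = record
            { refl  = ⊴-reflexive refl , ⊴-reflexive refl
            ; sym   = swap
            ; trans = λ (p , q) (p′ , q′) → ⊴-trans p p′ , ⊴-trans q′ q
            }
          ; reflexive = proj₂
          ; trans     = λ p q → ⊴-trans q p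
          }
        ; antisym = λ p q → q , p
        }
      ; total = λ (x , _) (y , _) → ⊴-total y x
      }
    }

  module Γ = TotalOrder Γ
  module Γ∞ = TotalOrder (Γ ∪∞)
  open Γ∞ using (_≤_) renaming (_≈_ to _≈⁺_)

  private
    -- The decision is an argument so that proofs can match on it.
    v′ : ∀ x → Dec (x ≈ ε) → Γ.Carrier ⁺
    v′ x (yes _)  = ⊤⁺
    v′ x (no x≉ε) = [ x , lift x≉ε ]

    v′-≤⇒⊴ : ∀ {x y} p q → v′ x p ≤ v′ y q → y ⊴ x
    v′-≤⇒⊴ p        (yes y≈ε) _                 = ⊴-trans (⊴-reflexive y≈ε) (ε-min _)
    v′-≤⇒⊴ (no _)   (no _)    AddSupremum.[ r ] = r
    v′-≤⇒⊴ (yes _)  (no _)    ()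

    v′-⊴⇒≤ : ∀ {x y} p q → y ⊴ x → v′ x p ≤ v′ y q
    v′-⊴⇒≤ p         (yes _)  _   = _ AddSupremum.≤⊤⁺
    v′-⊴⇒≤ (no _)    (no _)   y⊴x = AddSupremum.[ y⊴x ]
    v′-⊴⇒≤ (yes x≈ε) (no y≉ε) y⊴x =
      contradiction (⊴ε⇒≈ε (⊴-trans y⊴x (⊴-reflexive x≈ε))) y≉ε

    v′-∞ : ∀ {x} p → v′ x p ≈⁺ ⊤⁺ ⇔ x ≈ ε
    v′-∞ (yes x≈ε) = mk⇔ (λ _ → x≈ε) (λ _ → Γ∞.Eq.refl)
    v′-∞ (no x≉ε)  = mk⇔ (λ ()) (λ x≈ε → contradiction x≈ε x≉ε)

  v : Carrier → Γ.Carrier ⁺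
  v x = v′ x em

  ≤⇒⊴ : ∀ {x y} → v x ≤ v y → y ⊴ x
  ≤⇒⊴ = v′-≤⇒⊴ em em

  ⊴⇒≤ : ∀ {x y} → y ⊴ x → v x ≤ v y
  ⊴⇒≤ = v′-⊴⇒≤ em em

  <⇒⋬ : ∀ {x y} → _<_ (Γ ∪∞) (v x) (v y) → ¬ x ⊴ y
  <⇒⋬ (x≤y , x≉y) x⊴y = x≉y (Γ∞.antisym x≤y (⊴⇒≤ x⊴y))

  ⋬⇒< : ∀ {x y} → ¬ x ⊴ y → _<_ (Γ ∪∞) (v x) (v y)
  ⋬⇒< {x} {y} x⋬y with ⊴-total x y
  ... | inj₁ x⊴y = contradiction x⊴y x⋬y
  ... | inj₂ y⊴x = ⊴⇒≤ y⊴x , λ x≈y → x⋬y (≤⇒⊴ (Γ∞.reflexive (Γ∞.Eq.sym x≈y)))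

  [γ]≈v : ∀ γ → [ γ ] ≈⁺ v (proj₁ γ)
  [γ]≈v (x , lift x≉ε) = helper em
    where
    helper : ∀ p → [ x , lift x≉ε ] ≈⁺ v′ x p
    helper (yes x≈ε) = contradiction x≈ε x≉ε
    helper (no _)    = SupremumEquality.[ Γ.Eq.refl {x , lift x≉ε} ]

  v-cong : ∀ {x y} → x ≈ y → v x ≈⁺ v y
  v-cong x≈y = Γ∞.antisym (⊴⇒≤ (⊴-reflexive (sym x≈y))) (⊴⇒≤ (⊴-reflexive x≈y))

  v-surjective : Surjective _≈_ _≈⁺_ v
  v-surjective ⊤⁺    = ε , λ z≈ε → Γ∞.Eq.trans (v-cong z≈ε) (Equivalence.from (v′-∞ em) refl)
  v-surjective [ γ ] = proj₁ γ , λ z≈γ → Γ∞.Eq.trans (v-cong z≈γ) (Γ∞.Eq.sym ([γ]≈v γ))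

  private
    open Min (Γ ∪∞) using (_⊓_; ⊓-sel; x⊓y≤x; x⊓y≤y)

    v-min : ∀ x y → v x ⊓ v y ≤ v (x ∙ y ⁻¹)
    v-min x y with ⊓-sel (v x) (v y)
    ... | inj₁ e = Γ∞.trans (Γ∞.reflexive e) (⊴⇒≤ (⊴-div (⊴-reflexive refl)
                     (≤⇒⊴ (Γ∞.trans (Γ∞.reflexive (Γ∞.Eq.sym e)) (x⊓y≤y (v x) (v y))))))
    ... | inj₂ e = Γ∞.trans (Γ∞.reflexive e) (⊴⇒≤ (⊴-div
                     (≤⇒⊴ (Γ∞.trans (Γ∞.reflexive (Γ∞.Eq.sym e)) (x⊓y≤x (v x) (v y))))
                     (⊴-reflexive refl)))

    ⊴-conj⁻ : ∀ {x y} z → _^_ G x z ⊴ _^_ G y z → x ⊴ y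
    ⊴-conj⁻ z p = ⊴-trans (⊴-reflexive (sym (conj⁻¹-conj _ z)))
                    (⊴-trans (⊴-conj (z ⁻¹) p) (⊴-reflexive (conj⁻¹-conj _ z)))

  valuation : Valuation G Γ
  valuation = record
    { v      = v
    ; v-cong = v-cong
    ; v-∞    = λ _ → v′-∞ em
    ; v-min  = v-min
    ; v-conj = λ _ _ z → mk⇔ (⊴⇒≤ ∘ ⊴-conj z ∘ ≤⇒⊴) (⊴⇒≤ ∘ ⊴-conj⁻ z ∘ ≤⇒⊴)
    }

-- The strict weak order of a C-relation.

module CRelation (em : ∀ {a} → ExcludedMiddle a)
  {c ℓ r} {G : Group c ℓ} {C : Rel₃ (Group.Carrier G) r}
  (isC : IsCompatibleCRelation G C) where

  open Group G
  open IsCompatibleCRelation isC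
  open GroupProperties G
  open Conjugation G

  dne : ∀ {a} → DoubleNegationElimination a
  dne = em⇒dne em

  infix 4 _≺_ _≼_ _≪_ _≼±_ _⊑_ _∈U_ _∈S_ _⊴_

  _≺_ _≼_ : Rel Carrier r
  y ≺ x = C x y ε
  x ≼ y = ¬ y ≺ x

  C-translateʳ : ∀ {x y z} u → C x y z → C (x ∙ u) (y ∙ u) (z ∙ u)
  C-translateʳ u p = C-cong e e e (compatible u ε p)
    where e : ∀ {x} → ε ∙ x ∙ u ≈ x ∙ u
          e = ∙-congʳ (identityˡ _)

  C-translateˡ : ∀ {x y z} u → C x y z → C (u ∙ x) (u ∙ y) (u ∙ z)
  C-translateˡ u p = C-cong (identityʳ _) (identityʳ _) (identityʳ _) (compatible ε u p)

  -- Right translation moves the base point z to `ε`; with the converse below, `≺` determines `C`.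
  C⇒≺ : ∀ {x y z} → C x y z → y ∙ z ⁻¹ ≺ x ∙ z ⁻¹
  C⇒≺ p = C-cong refl refl (inverseʳ _) (C-translateʳ _ p)

  ≺⇒C : ∀ {x y z} → y ∙ z ⁻¹ ≺ x ∙ z ⁻¹ → C x y z
  ≺⇒C {z = z} p = C-cong e e (identityˡ z) (C-translateʳ z p)
    where e : ∀ {x} → x ∙ z ⁻¹ ∙ z ≈ x
          e = //-rightDividesˡ z _

  C-irrefl : ∀ {x z} → ¬ C x x z
  C-irrefl p = C-asym p p

  C⇒≉ : ∀ {x y z} → C x y z → ¬ x ≈ z
  C⇒≉ p x≈z = C-irrefl (C-swap (C-cong refl refl (sym x≈z) p))

  ≺-cong : ∀ {x x′ y y′} → x ≈ x′ → y ≈ y′ → x ≺ y → x′ ≺ y′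
  ≺-cong x≈ y≈ = C-cong y≈ x≈ refl

  ≺-cotrans : ∀ {x y} z → x ≺ y → x ≺ z ⊎ z ≺ y
  ≺-cotrans z = C-cotrans z

  ≼-≺-trans : ∀ {x y z} → x ≼ y → y ≺ z → x ≺ z
  ≼-≺-trans {x} x≼y y≺z = [ (λ y≺x → contradiction y≺x x≼y) , id ]′ (≺-cotrans x y≺z)

  ≺-≼-trans : ∀ {x y z} → x ≺ y → y ≼ z → x ≺ z
  ≺-≼-trans {z = z} x≺y y≼z = [ id , (λ z≺y → contradiction z≺y y≼z) ]′ (≺-cotrans z x≺y)

  ≺⇒≼ : ∀ {x y} → x ≺ y → x ≼ y
  ≺⇒≼ = C-asym

  ≺-trans : ∀ {x y z} → x ≺ y → y ≺ z → x ≺ z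
  ≺-trans x≺y = ≼-≺-trans (≺⇒≼ x≺y)

  ≼-trans : ∀ {x y z} → x ≼ y → y ≼ z → x ≼ z
  ≼-trans x≼y y≼z z≺x = y≼z (≺-≼-trans z≺x x≼y)

  ≼-reflexive : ∀ {x y} → x ≈ y → x ≼ y
  ≼-reflexive x≈y y≺x = C-irrefl (≺-cong (sym x≈y) refl y≺x)

  ε-≺ : ∀ {x} → ¬ x ≈ ε → ε ≺ x
  ε-≺ = C-distinct

  ε-≼ : ∀ {x} → ε ≼ x
  ε-≼ p = C⇒≉ p refl

  ≼ε⇒≈ε : ∀ {x} → x ≼ ε → x ≈ ε
  ≼ε⇒≈ε x≼ε = dne (x≼ε ∘ ε-≺)

  ≺-conj : ∀ {x y} z → x ≺ y → _^_ G x z ≺ _^_ G y z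
  ≺-conj z p = C-cong refl refl (conj-ε z)
                 (compatible (z ⁻¹) z p)

  -- Swapping makes x the base point, and translation then moves it to `ε`.
  ≺-divʳ : ∀ {x y} → x ≺ y → x ⁻¹ ≺ y ∙ x ⁻¹
  ≺-divʳ p = ≺-cong (identityˡ _) refl (C⇒≺ (C-swap p))

  ≺-divˡ : ∀ {x y} → x ≺ y → x ⁻¹ ≺ x ⁻¹ ∙ y
  ≺-divˡ {x} p = C-cong refl (identityʳ _) (inverseˡ _) (C-translateˡ (x ⁻¹) (C-swap p))

  ⁻¹-≉ε : ∀ {x} → ¬ x ≈ ε → ¬ x ⁻¹ ≈ ε
  ⁻¹-≉ε x≉ε p = x≉ε (trans (sym (⁻¹-involutive _)) (trans (⁻¹-cong p) ε⁻¹≈ε))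

  -- `⊑` is the comparison forced on two elements that some U k, or some S k with k negative,
  -- separates.
  _≪_ _≼±_ _⊑_ : Rel Carrier r
  x ≪ y  = x ≺ y × x ≺ y ⁻¹
  x ≼± y = x ≼ y × x ≼ y ⁻¹
  x ⊑ y  = x ≼± y × x ⁻¹ ≼± y

  -- Translating x ≺ y gives C(x⁻¹, y⁻¹, x⁻¹y⁻¹). Cotransitivity at `ε` leaves two cases: one
  -- translates by y to the claim, the other says x⁻¹y⁻¹ ≺ x⁻¹, against x ≺ y⁻¹ divided by x.
  ≪⇒⁻¹≺ : ∀ {x y} → x ≪ y → x ⁻¹ ≺ y
  ≪⇒⁻¹≺ {x} {y} (x≺y , x≺y⁻¹) with C-cotrans ε p
    where
    p : C (x ⁻¹) (y ⁻¹) (x ⁻¹ ∙ y ⁻¹)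
    p = C-swap (C-cong (//-rightDividesʳ y _) refl (identityˡ _)
          (C-translateʳ (y ⁻¹) (≺-divˡ x≺y)))
  ... | inj₁ q = C-cong (identityˡ y) (//-rightDividesˡ y _) (inverseˡ y)
                   (C-translateʳ y (C-swap q))
  ... | inj₂ q = contradiction (C-swap q) (C-asym (≺-divˡ x≺y⁻¹))

  ≪-⁻¹ʳ : ∀ {x y} → x ≪ y → x ≪ y ⁻¹
  ≪-⁻¹ʳ (p , q) = q , ≺-cong refl (sym (⁻¹-involutive _)) p

  ≪-⁻¹ˡ : ∀ {x y} → x ≪ y → x ⁻¹ ≪ y
  ≪-⁻¹ˡ p = ≪⇒⁻¹≺ p , ≪⇒⁻¹≺ (≪-⁻¹ʳ p)

  -- Dividing on the right turns the two relations into y⁻¹ ≺ x and x ≺ y⁻¹.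
  ≺-∙-¬≺ : ∀ {x y} → y ≺ x ∙ y → ¬ x ⁻¹ ≺ (x ∙ y) ⁻¹
  ≺-∙-¬≺ {x} {y} p q = C-asym y⁻¹≺x x≺y⁻¹
    where
    y⁻¹≺x : y ⁻¹ ≺ x
    y⁻¹≺x = ≺-cong refl (//-rightDividesʳ y x) (≺-divʳ p)
    x≺y⁻¹ : x ≺ y ⁻¹
    x≺y⁻¹ = ≺-cong (⁻¹-involutive x)
      (trans (∙-cong (⁻¹-anti-homo-∙ x y) (⁻¹-involutive x)) (//-rightDividesˡ x _)) (≺-divʳ q)

  ≪⇒⊑ : ∀ {x y} → x ≪ y → x ⊑ y
  ≪⇒⊑ p = (≺⇒≼ (proj₁ p) , ≺⇒≼ (proj₂ p)) , (≺⇒≼ (proj₁ q) , ≺⇒≼ (proj₂ q))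
    where q = ≪-⁻¹ˡ p

  -- The subgroups U k and S k.

  _∈U_ _∈S_ : Rel Carrier r
  x ∈U k = ¬ k ≪ x
  x ∈S k = x ≼ k × x ⁻¹ ≼ k

  ⊑-∈S : ∀ {k x y} → x ⊑ y → y ∈S k → x ∈S k
  ⊑-∈S ((x≼y , _) , (x⁻¹≼y , _)) (y≼k , _) = ≼-trans x≼y y≼k , ≼-trans x⁻¹≼y y≼k

  ⊑-∈U : ∀ {k x y} → x ⊑ y → y ∈U k → x ∈U k
  ⊑-∈U ((x≼y , x≼y⁻¹) , _) y∈U (k≺x , _) = y∈U (≺-≼-trans k≺x x≼y , ≺-≼-trans k≺x x≼y⁻¹)

  ≪-transˡ : ∀ {x y z} → x ≼ y → y ≪ z → x ≪ z
  ≪-transˡ x≼y (p , q) = ≼-≺-trans x≼y p , ≼-≺-trans x≼y q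

  -- Recovers the disjunctive description of U k from the negated one, which is easier to transport.
  ∈U-split : ∀ {k x} → x ∈U k → x ≼ k ⊎ x ⁻¹ ≼ k
  ∈U-split {k} {x} x∈U with em {P = k ≺ x}
  ... | yes k≺x = inj₂ λ k≺x⁻¹ → x∈U (k≺x , k≺x⁻¹)
  ... | no  x≼k = inj₁ x≼k

  -- Even if only x⁻¹ lies below k, inverting the left side of `≪` brings x back.
  ∈U-≪ : ∀ {k x y} → x ∈U k → k ≪ y → x ≪ y
  ∈U-≪ x∈U k≪y with ∈U-split x∈U
  ... | inj₁ x≼k   = ≪-transˡ x≼k k≪y
  ... | inj₂ x⁻¹≼k = let (p , q) = ≪-⁻¹ˡ (≪-transˡ x⁻¹≼k k≪y) in
                     ≺-cong (⁻¹-involutive _) refl p , ≺-cong (⁻¹-involutive _) refl q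

  ∈S⇒∈U : ∀ {k x} → x ∈S k → x ∈U k
  ∈S⇒∈U (x≼k , _) (k≺x , _) = x≼k k≺x

  ⁻¹-∈U : ∀ {k x} → x ∈U k → x ⁻¹ ∈U k
  ⁻¹-∈U x∈U (p , q) = x∈U (≺-cong refl (⁻¹-involutive _) q , p)

  ⁻¹-∈S : ∀ {k x} → x ∈S k → x ⁻¹ ∈S k
  ⁻¹-∈S (p , q) = q , λ k≺ → p (≺-cong refl (⁻¹-involutive _) k≺)

  -- If k ≪ xy, then x and y are both ≪ xy, so y ≺ xy and x⁻¹ ≺ (xy)⁻¹, which exclude each other.
  ∙-∈U : ∀ {k x y} → x ∈U k → y ∈U k → x ∙ y ∈U k
  ∙-∈U x∈U y∈U k≪xy =
    ≺-∙-¬≺ (proj₁ (∈U-≪ y∈U k≪xy)) (proj₂ (≪-⁻¹ˡ (∈U-≪ x∈U k≪xy)))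

  module _ {k} (k≼k⁻¹ : k ≼ k ⁻¹) where

    -- As k ≼ k⁻¹, x ≺ k already amounts to x ≪ k.
    ≺⇒⁻¹≺ : ∀ {x} → x ≺ k → x ⁻¹ ≺ k
    ≺⇒⁻¹≺ x≺k = ≪⇒⁻¹≺ (x≺k , ≺-≼-trans x≺k k≼k⁻¹)

    ∉S⇒≼± : ∀ {x} → ¬ x ∈S k → k ≼± x
    ∉S⇒≼± x∉S = (λ x≺k → x∉S (≺⇒≼ x≺k , ≺⇒≼ (≺⇒⁻¹≺ x≺k)))
      , λ x⁻¹≺k → x∉S (≺⇒≼ (≺-cong (⁻¹-involutive _) refl (≺⇒⁻¹≺ x⁻¹≺k)) , ≺⇒≼ x⁻¹≺k)

    ∈S-∉S⇒⊑ : ∀ {x y} → x ∈S k → ¬ y ∈S k → x ⊑ y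
    ∈S-∉S⇒⊑ (x≼k , x⁻¹≼k) y∉S = let (k≼y , k≼y⁻¹) = ∉S⇒≼± y∉S in
      (≼-trans x≼k k≼y , ≼-trans x≼k k≼y⁻¹) , (≼-trans x⁻¹≼k k≼y , ≼-trans x⁻¹≼k k≼y⁻¹)

    private
      -- Suppose k ≺ xy. Then y ≺ xy, and x ≺ xy divided by x gives x⁻¹ ≺ y ≼ k. Also k ≼ (xy)⁻¹,
      -- since (xy)⁻¹ ≺ k would invert to xy ≺ k. Hence x⁻¹ ≺ (xy)⁻¹, contradicting y ≺ xy.
      ∙-≼ : ∀ {x y} → x ∈S k → y ∈S k → x ∙ y ≼ k
      ∙-≼ {x} {y} (x≼k , _) (y≼k , _) k≺xy = ≺-∙-¬≺ y≺xy (≺-≼-trans x⁻¹≺k k≼⁻¹)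
        where
        y≺xy : y ≺ x ∙ y
        y≺xy = ≼-≺-trans y≼k k≺xy
        x⁻¹≺y : x ⁻¹ ≺ y
        x⁻¹≺y = ≺-cong refl (\\-leftDividesʳ x y) (≺-divˡ (≼-≺-trans x≼k k≺xy))
        x⁻¹≺k : x ⁻¹ ≺ k
        x⁻¹≺k = ≺-≼-trans x⁻¹≺y y≼k
        k≼⁻¹ : k ≼ (x ∙ y) ⁻¹
        k≼⁻¹ q = C-asym k≺xy (≺-cong (⁻¹-involutive _) refl (≺⇒⁻¹≺ q))

    ∙-∈S : ∀ {x y} → x ∈S k → y ∈S k → x ∙ y ∈S k
    ∙-∈S {x} {y} x∈S y∈S = ∙-≼ x∈S y∈S
      , λ p → ∙-≼ (⁻¹-∈S y∈S) (⁻¹-∈S x∈S) (≺-cong refl (⁻¹-anti-homo-∙ x y) p)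

  ∈U-∉U⇒⊑ : ∀ {k x y} → x ∈U k → ¬ y ∈U k → x ⊑ y
  ∈U-∉U⇒⊑ x∈U y∉U = ≪⇒⊑ (∈U-≪ x∈U (dne y∉U))

  -- The valuation preorder defined by the chain of cuts.

  Neg : Carrier → Set r
  Neg k = k ≺ k ⁻¹

  -- Containment in the chain members: a smaller element has a larger value. The trivial subgroup
  -- joins the chain so that only `ε` gets the value ∞.
  record _⊴_ (x y : Carrier) : Set (c ⊔ ℓ ⊔ r) where
    field
      ε-cut : y ≈ ε → x ≈ ε
      U-cut : ∀ k → Neg k → y ∈U k → x ∈U k
      S-cut : ∀ k → Neg k → y ∈S k → x ∈S k

  open _⊴_

  ⊑⇒⊴ : ∀ {x y} → x ⊑ y → x ⊴ y
  ⊑⇒⊴ x⊑y = record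
    { ε-cut = λ y≈ε → ≼ε⇒≈ε (≼-trans (proj₁ (proj₁ x⊑y)) (≼-reflexive y≈ε))
    ; U-cut = λ _ _ → ⊑-∈U x⊑y
    ; S-cut = λ _ _ → ⊑-∈S x⊑y
    }

  ⊴-reflexive : ∀ {x y} → x ≈ y → x ⊴ y
  ⊴-reflexive x≈y = record
    { ε-cut = trans x≈y
    ; U-cut = λ _ _ y∈U (p , q) → y∈U (≺-cong refl x≈y p , ≺-cong refl (⁻¹-cong x≈y) q)
    ; S-cut = λ _ _ (p , q) → ≼-trans (≼-reflexive x≈y) p
                            , ≼-trans (≼-reflexive (⁻¹-cong x≈y)) q
    }

  ⊴-trans : ∀ {x y z} → x ⊴ y → y ⊴ z → x ⊴ z
  ⊴-trans p q = record
    { ε-cut = ε-cut p ∘ ε-cut q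
    ; U-cut = λ k k- → U-cut p k k- ∘ U-cut q k k-
    ; S-cut = λ k k- → S-cut p k k- ∘ S-cut q k k-
    }

  ≈ε⇒⊑ : ∀ {x y} → x ≈ ε → x ⊑ y
  ≈ε⇒⊑ x≈ε = (≼-trans e ε-≼ , ≼-trans e ε-≼) , (≼-trans e′ ε-≼ , ≼-trans e′ ε-≼)
    where
    e  = ≼-reflexive x≈ε
    e′ = ≼-reflexive (trans (⁻¹-cong x≈ε) ε⁻¹≈ε)

  -- Some cut contains y but not x, and each of the three kinds of cut then forces y ⊑ x. Totality
  -- of `⊴` and its link with `≼` both rest on this.
  ⋬⇒⊑ : ∀ {x y} → ¬ x ⊴ y → y ⊑ x
  ⋬⇒⊑ {x} {y} x⋬y = dne λ y⋢x → x⋬y record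
    { ε-cut = λ y≈ε → contradiction (≈ε⇒⊑ y≈ε) y⋢x
    ; U-cut = λ k _ y∈U → dne λ x∉U → y⋢x (∈U-∉U⇒⊑ y∈U x∉U)
    ; S-cut = λ k k- y∈S → dne λ x∉S → y⋢x (∈S-∉S⇒⊑ (≺⇒≼ k-) y∈S x∉S)
    }

  ⋬⇒≼ : ∀ {x y} → ¬ x ⊴ y → y ≼ x
  ⋬⇒≼ x⋬y = proj₁ (proj₁ (⋬⇒⊑ x⋬y))

  ⊴-total : ∀ x y → x ⊴ y ⊎ y ⊴ x
  ⊴-total x y with em {P = x ⊴ y}
  ... | yes x⊴y = inj₁ x⊴y
  ... | no  x⋬y = inj₂ (⊑⇒⊴ (⋬⇒⊑ x⋬y))

  ⊴-div : ∀ {x y z} → x ⊴ z → y ⊴ z → (x ∙ y ⁻¹) ⊴ z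
  ⊴-div x⊴z y⊴z = record
    { ε-cut = λ z≈ε → x≈y⇒x∙y⁻¹≈ε (trans (ε-cut x⊴z z≈ε) (sym (ε-cut y⊴z z≈ε)))
    ; U-cut = λ k k- z∈U → ∙-∈U (U-cut x⊴z k k- z∈U) (⁻¹-∈U (U-cut y⊴z k k- z∈U))
    ; S-cut = λ k k- z∈S →
        ∙-∈S (≺⇒≼ k-) (S-cut x⊴z k k- z∈S) (⁻¹-∈S (S-cut y⊴z k k- z∈S))
    }

  -- Conjugation permutes the cuts: the one at k pulls back along z to the one at z⁻¹kz, which is
  -- again negative.
  ⊴-conj : ∀ {x y} z → x ⊴ y → _^_ G x z ⊴ _^_ G y z
  ⊴-conj {x} {y} z x⊴y = record
    { ε-cut = λ yᶻ≈ε → trans (conj-cong z (ε-cut x⊴y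
        (trans (sym (conj⁻¹-conj y z)) (trans (conj-cong (z ⁻¹) yᶻ≈ε) (conj-ε (z ⁻¹))))))
        (conj-ε z)
    ; U-cut = λ k k- yᶻ∈U (p , q) → U-cut x⊴y (_^_ G k (z ⁻¹)) (neg k-)
        (λ (p′ , q′) → yᶻ∈U (up p′ , ≺-cong refl (conj-⁻¹ y z) (up q′)))
        (down p , down (≺-cong refl (sym (conj-⁻¹ x z)) q))
    ; S-cut = λ k k- (p , q) →
        let (p′ , q′) = S-cut x⊴y (_^_ G k (z ⁻¹)) (neg k-)
              (p ∘ up , λ s → q (≺-cong refl (conj-⁻¹ y z) (up s)))
        in p′ ∘ down , λ s → q′ (down (≺-cong refl (sym (conj-⁻¹ x z)) s))
    }
    where
    up : ∀ {k w} → _^_ G k (z ⁻¹) ≺ w → k ≺ _^_ G w z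
    up p = ≺-cong (conj-conj⁻¹ _ z) refl (≺-conj z p)
    down : ∀ {k w} → k ≺ _^_ G w z → _^_ G k (z ⁻¹) ≺ w
    down p = ≺-cong refl (conj⁻¹-conj _ z) (≺-conj (z ⁻¹) p)
    neg : ∀ {k} → Neg k → Neg (_^_ G k (z ⁻¹))
    neg k- = ≺-cong refl (conj-⁻¹ _ (z ⁻¹)) (≺-conj (z ⁻¹) k-)

  ⊴-isValuationPreorder : IsValuationPreorder G _⊴_
  ⊴-isValuationPreorder = record
    { ⊴-reflexive = ⊴-reflexive
    ; ⊴-trans     = ⊴-trans
    ; ⊴-total     = ⊴-total
    ; ε-min       = λ _ → ⊑⇒⊴ (≈ε⇒⊑ refl)
    ; ⊴ε⇒≈ε       = λ x⊴ε → ε-cut x⊴ε refl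
    ; ⊴-div       = ⊴-div
    ; ⊴-conj      = ⊴-conj
    }

  -- Values of negative elements.

  module _ {k} (k- : Neg k) where

    neg⇒∈U : k ∈U k
    neg⇒∈U (k≺k , _) = C-irrefl k≺k

    neg⇒∉S : ¬ k ∈S k
    neg⇒∉S (_ , k⁻¹≼k) = k⁻¹≼k k-

    neg⇒≉ε : ¬ k ≈ ε
    neg⇒≉ε k≈ε = ε-≼ (≺-cong refl (trans (⁻¹-cong k≈ε) ε⁻¹≈ε) k-)

    -- No cut of the chain containing k is smaller than U k: j ≪ x forces j ≪ k, and k ∈ S j forces
    -- k ≪ j, hence x ≪ j.
    ∈U⇒⊴ : ∀ {x} → x ∈U k → x ⊴ k
    ∈U⇒⊴ {x} x∈U = record
      { ε-cut = λ k≈ε → contradiction k≈ε neg⇒≉ε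
      ; U-cut = λ j _ k∈U j≪x → k∈U (∈U-between (∈U-split x∈U) j≪x)
      ; S-cut = λ j j- (_ , k⁻¹≼j) →
          let k≺j = ≺-≼-trans k- k⁻¹≼j
              x≪j = ∈U-≪ x∈U (k≺j , ≺-trans k≺j j-)
          in ≺⇒≼ (proj₁ x≪j) , ≺⇒≼ (≪⇒⁻¹≺ x≪j)
      }
      where
      ∈U-between : ∀ {j} → x ≼ k ⊎ x ⁻¹ ≼ k → j ≪ x → j ≪ k
      ∈U-between (inj₁ x≼k)   (p , _) = ≺-≼-trans p x≼k , ≺-trans (≺-≼-trans p x≼k) k-
      ∈U-between (inj₂ x⁻¹≼k) (_ , q) = ≺-≼-trans q x⁻¹≼k , ≺-trans (≺-≼-trans q x⁻¹≼k) k-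

    -- A cut containing an element outside S k contains k; in the case of S j this holds because j ≼
    -- k would put x into S k.
    ∉S⇒⊵ : ∀ {x} → ¬ x ∈S k → k ⊴ x
    ∉S⇒⊵ {x} x∉S = record
      { ε-cut = λ x≈ε → let ((x≼k , _) , (x⁻¹≼k , _)) = ≈ε⇒⊑ x≈ε in
                  contradiction (x≼k , x⁻¹≼k) x∉S
      ; U-cut = λ j _ x∈U (j≺k , _) → let (k≼x , k≼x⁻¹) = ∉S⇒≼± (≺⇒≼ k-) x∉S in
                  x∈U (≺-≼-trans j≺k k≼x , ≺-≼-trans j≺k k≼x⁻¹)
      ; S-cut = λ j j- (x≼j , x⁻¹≼j) →
          let k≺j = dne λ j≼k → x∉S (≼-trans x≼j j≼k , ≼-trans x⁻¹≼j j≼k)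
          in ≺⇒≼ k≺j , ≺⇒≼ (≪⇒⁻¹≺ (k≺j , ≺-trans k≺j j-))
      }

  -- As y is nontrivial, the separating cut is some U k or S k. Since S k lies in U k, both cases
  -- take this form, which gives v(x) ≤ v(k) ≤ v(y).
  ⋬⇒separated : ∀ {x y} → ¬ x ⊴ y → ¬ y ≈ ε →
                Σ[ k ∈ Carrier ] Neg k × y ∈U k × ¬ x ∈S k
  ⋬⇒separated x⋬y y≉ε = dne λ ¬k → x⋬y record
    { ε-cut = λ y≈ε → contradiction y≈ε y≉ε
    ; U-cut = λ k k- y∈U k≪x → ¬k (k , k- , y∈U , λ (x≼k , _) → x≼k (proj₁ k≪x))
    ; S-cut = λ k k- y∈S → dne λ x∉S → ¬k (k , k- , ∈S⇒∈U y∈S , x∉S)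
    }

  -- Criteria for the two elementary types.

  valuational : (∀ x → x ≼ x ⁻¹) → Valuational G C
  valuational ≼⁻¹ = record
    { Γ         = V.Γ
    ; valuation = V.valuation
    ; C⇔        = λ x y z → mk⇔
        (λ p → V.⋬⇒< λ (lift q) → q (C⇒≺ p))
        (λ p → ≺⇒C (dne λ q → V.<⇒⋬ p (lift q)))
    }
    where
    ⁻¹≼ : ∀ x → x ⁻¹ ≼ x
    ⁻¹≼ x = ≼-trans (≼⁻¹ (x ⁻¹)) (≼-reflexive (⁻¹-involutive x))

    -- Inverse elements are `≼`-equivalent, so z ≺ xy⁻¹ would give y⁻¹ ≺ xy⁻¹ and x⁻¹ ≺ (xy⁻¹)⁻¹ at
    -- once.
    div : ∀ {x y z} → x ≼ z → y ≼ z → x ∙ y ⁻¹ ≼ z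
    div {x} {y} x≼z y≼z z≺xy⁻¹ = ≺-∙-¬≺
      (≼-≺-trans (⁻¹≼ y) (≼-≺-trans y≼z z≺xy⁻¹))
      (≺-≼-trans (≼-≺-trans (⁻¹≼ x) (≼-≺-trans x≼z z≺xy⁻¹)) (≼⁻¹ (x ∙ y ⁻¹)))

    total : ∀ x y → x ≼ y ⊎ y ≼ x
    total x y with em {P = x ≺ y}
    ... | yes x≺y = inj₁ (≺⇒≼ x≺y)
    ... | no  y≼x = inj₂ y≼x

    conj : ∀ {x y} z → x ≼ y → _^_ G x z ≼ _^_ G y z
    conj z x≼y yᶻ≺xᶻ =
      x≼y (≺-cong (conj⁻¹-conj _ z) (conj⁻¹-conj _ z) (≺-conj (z ⁻¹) yᶻ≺xᶻ))

    isValuationPreorder : IsValuationPreorder G (λ x y → Lift (c ⊔ ℓ) (x ≼ y))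
    isValuationPreorder = record
      { ⊴-reflexive = λ x≈y → lift (≼-reflexive x≈y)
      ; ⊴-trans     = λ (lift p) (lift q) → lift (≼-trans p q)
      ; ⊴-total     = λ x y → Sum.map lift lift (total x y)
      ; ε-min       = λ _ → lift ε-≼
      ; ⊴ε⇒≈ε       = λ (lift p) → ≼ε⇒≈ε p
      ; ⊴-div       = λ (lift p) (lift q) → lift (div p q)
      ; ⊴-conj      = λ z (lift p) → lift (conj z p)
      }

    module V = PreorderValuation em isValuationPreorder

  -- A valuation agrees on x and x⁻¹, so neither can be strictly above the other.
  valuational⇒≼⁻¹ : Valuational G C → ∀ x → x ≼ x ⁻¹
  valuational⇒≼⁻¹ W x p = proj₂ v< (Γ∞.antisym (proj₁ v<) v≥)
    where
    open Valuational W using (Γ; valuation; C⇔)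
    open Valuation valuation
    module Γ∞ where
      open TotalOrder (Γ ∪∞) public
      open Min (Γ ∪∞) public
    open Γ∞ using (_≤_)

    vε≈∞ : v ε Γ∞.≈ ⊤⁺
    vε≈∞ = Equivalence.from (v-∞ ε) refl

    v-⁻¹ : ∀ g → v g ≤ v (g ⁻¹)
    v-⁻¹ g = Γ∞.trans
      (Γ∞.⊓-glb (Γ∞.trans (_ AddSupremum.≤⊤⁺) (Γ∞.reflexive (Γ∞.Eq.sym vε≈∞))) Γ∞.refl)
      (Γ∞.trans (v-min ε g) (Γ∞.reflexive (v-cong (identityˡ _))))

    v< : _<_ (Γ ∪∞) (v (x ∙ ε ⁻¹)) (v (x ⁻¹ ∙ ε ⁻¹))
    v< = Equivalence.to (C⇔ _ _ _) p
    v≥ : v (x ⁻¹ ∙ ε ⁻¹) ≤ v (x ∙ ε ⁻¹)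
    v≥ = Γ∞.trans (v-⁻¹ _) (Γ∞.reflexive (v-cong (trans (⁻¹-anti-homo-// _ _)
           (trans (identityˡ _) (trans (⁻¹-involutive x)
             (sym (trans (∙-congˡ ε⁻¹≈ε) (identityʳ x))))))))

  -- The elements with `Neg` form the negative cone of the order: `neg?` gives totality, closure
  -- under products transitivity, and conjugation invariance the left translations.
  orderType : (∀ {x} → ¬ x ≈ ε → Neg x ⊎ Neg (x ⁻¹)) →
              (∀ {x y} → Neg x → Neg y → x ≼ y) →
              OrderType G C
  orderType neg? neg-≼ = record
    { _≤_       = λ x y → Lift c (x ≈ y ⊎ x ⊏ y)
    ; isBiOrder = record
      { isTotalOrder = record
        { isPartialOrder = record
          { isPreorder = record
            { isEquivalence = isEquivalence
            ; reflexive     = λ x≈y → lift (inj₁ x≈y)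
            ; trans         = λ (lift p) (lift q) → lift (≤-trans p q)
            }
          ; antisym = λ (lift p) (lift q) → ≤-antisym p q
          }
        ; total = λ x y → Sum.map lift lift (≤-total x y)
        }
      ; mulʳ = λ z (lift p) → lift (Sum.map ∙-congʳ (⊏-∙ʳ z) p)
      ; mulˡ = λ z (lift p) → lift (Sum.map ∙-congˡ (⊏-∙ˡ z) p)
      }
    ; C⇔ = λ x y z → mk⇔ (to x y z) (from x y z)
    }
    where
    infix 4 _⊏_
    _⊏_ : Rel Carrier r
    x ⊏ y = Neg (x ∙ y ⁻¹)

    neg-cong : ∀ {x y} → x ≈ y → Neg x → Neg y
    neg-cong x≈y = ≺-cong x≈y (⁻¹-cong x≈y)

    neg-asym : ∀ {x} → Neg x → ¬ Neg (x ⁻¹)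
    neg-asym p q = C-asym p (≺-cong refl (⁻¹-involutive _) q)

    -- From x ≼ y ≺ y⁻¹ follows x⁻¹ ≺ (xy)⁻¹. Were (xy)⁻¹ negative, it would be ≼ x ≺ x⁻¹.
    neg-∙ : ∀ {x y} → Neg x → Neg y → Neg (x ∙ y)
    neg-∙ {x} {y} x- y- =
      [ id , (λ xy⁻¹- → contradiction (≼-≺-trans (neg-≼ xy⁻¹- x-) x-) (≺⇒≼ x⁻¹≺)) ]′
        (neg? (λ xy≈ε → ε-≼ (≺-cong refl (trans (⁻¹-cong xy≈ε) ε⁻¹≈ε) x⁻¹≺)))
      where
      x⁻¹≺ : x ⁻¹ ≺ (x ∙ y) ⁻¹
      x⁻¹≺ = ≺-cong refl (sym (⁻¹-anti-homo-∙ x y)) (≺-divʳ (≼-≺-trans (neg-≼ x- y-) y-))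

    neg⇒≺ : ∀ {x y} → Neg x → Neg (y ⁻¹) → x ≺ y
    neg⇒≺ x- y⁻¹- = ≺-cong refl (⁻¹-involutive _) (≼-≺-trans (neg-≼ x- y⁻¹-) y⁻¹-)

    -- Negative elements form the lowest nontrivial class, so nothing nontrivial is strictly below
    -- them.
    ≺⇒pos : ∀ {x y} → ¬ x ≈ ε → x ≺ y → Neg (y ⁻¹)
    ≺⇒pos {x} {y} x≉ε x≺y
      with neg? (λ y≈ε → ε-≼ (≺-cong refl y≈ε x≺y)) | neg? x≉ε
    ... | inj₂ y⁻¹- | _         = y⁻¹-
    ... | inj₁ y-   | inj₁ x-   = contradiction x≺y (neg-≼ y- x-)
    ... | inj₁ y-   | inj₂ x⁻¹- = contradiction (neg⇒≺ y- x⁻¹-) (≺⇒≼ x≺y)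

    ⊏⇒pos : ∀ {x y} → x ⊏ y → Neg ((y ∙ x ⁻¹) ⁻¹)
    ⊏⇒pos p = neg-cong (sym (⁻¹-anti-homo-// _ _)) p

    pos⇒⊏ : ∀ {x y} → Neg ((y ∙ x ⁻¹) ⁻¹) → x ⊏ y
    pos⇒⊏ p = neg-cong (⁻¹-anti-homo-// _ _) p

    ⊏-trans : ∀ {x y z} → x ⊏ y → y ⊏ z → x ⊏ z
    ⊏-trans p q = neg-cong (trans (assoc _ _ _) (∙-congˡ (\\-leftDividesʳ _ _))) (neg-∙ p q)

    ≉ : ∀ {x y} → ¬ x ≈ y → ¬ x ∙ y ⁻¹ ≈ ε
    ≉ x≉y = x≉y ∘ x∙y⁻¹≈ε⇒x≈y _ _

    ⊏⇒≉ : ∀ {x y} → x ⊏ y → ¬ x ≈ y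
    ⊏⇒≉ x⊏y x≈y = neg⇒≉ε x⊏y (x≈y⇒x∙y⁻¹≈ε x≈y)

    ≤-trans : ∀ {x y z} → x ≈ y ⊎ x ⊏ y → y ≈ z ⊎ y ⊏ z → x ≈ z ⊎ x ⊏ z
    ≤-trans (inj₁ x≈y) (inj₁ y≈z) = inj₁ (trans x≈y y≈z)
    ≤-trans (inj₁ x≈y) (inj₂ y⊏z) = inj₂ (neg-cong (∙-congʳ (sym x≈y)) y⊏z)
    ≤-trans (inj₂ x⊏y) (inj₁ y≈z) = inj₂ (neg-cong (∙-congˡ (⁻¹-cong y≈z)) x⊏y)
    ≤-trans (inj₂ x⊏y) (inj₂ y⊏z) = inj₂ (⊏-trans x⊏y y⊏z)

    ≤-antisym : ∀ {x y} → x ≈ y ⊎ x ⊏ y → y ≈ x ⊎ y ⊏ x → x ≈ y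
    ≤-antisym (inj₁ x≈y) _          = x≈y
    ≤-antisym (inj₂ x⊏y) (inj₁ y≈x) = sym y≈x
    ≤-antisym (inj₂ x⊏y) (inj₂ y⊏x) = contradiction (⊏⇒pos x⊏y) (neg-asym y⊏x)

    ≤-total : ∀ x y → (x ≈ y ⊎ x ⊏ y) ⊎ (y ≈ x ⊎ y ⊏ x)
    ≤-total x y with em {P = x ≈ y}
    ... | yes x≈y = inj₁ (inj₁ x≈y)
    ... | no  x≉y = Sum.map inj₂ (inj₂ ∘ pos⇒⊏) (neg? (≉ x≉y))

    ⊏-∙ʳ : ∀ {x y} z → x ⊏ y → x ∙ z ⊏ y ∙ z
    ⊏-∙ʳ {x} {y} z = neg-cong (sym (trans (∙-congˡ (⁻¹-anti-homo-∙ y z))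
      (trans (sym (assoc _ _ _)) (∙-congʳ (//-rightDividesʳ z x)))))

    ⊏-∙ˡ : ∀ {x y} z → x ⊏ y → z ∙ x ⊏ z ∙ y
    ⊏-∙ˡ {x} {y} z x⊏y = neg-cong
      (trans (∙-congʳ (sym (assoc _ _ _)))
        (trans (assoc _ _ _) (∙-congˡ (sym (⁻¹-anti-homo-∙ z y)))))
      (≺-cong refl (conj-⁻¹ _ z) (≺-conj z x⊏y))

    _<′_ : Rel Carrier (c ⊔ ℓ ⊔ r)
    x <′ y = Lift c (x ≈ y ⊎ x ⊏ y) × ¬ x ≈ y

    ⊏⇒< : ∀ {x y} → x ⊏ y → x <′ y
    ⊏⇒< x⊏y = lift (inj₂ x⊏y) , ⊏⇒≉ x⊏y

    <⇒⊏ : ∀ {x y} → x <′ y → x ⊏ y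
    <⇒⊏ (lift (inj₁ x≈y) , x≉y) = contradiction x≈y x≉y
    <⇒⊏ (lift (inj₂ x⊏y) , _)   = x⊏y

    C⇒⊏ : ∀ {x y z} → C x y z → ¬ y ≈ z → z ⊏ x
    C⇒⊏ p y≉z = pos⇒⊏ (≺⇒pos (≉ y≉z) (C⇒≺ p))

    to : ∀ x y z → C x y z → (y <′ x × z <′ x) ⊎ (y ≈ z × ¬ z ≈ x)
    to x y z p with em {P = y ≈ z}
    ... | yes y≈z = inj₂ (y≈z , C⇒≉ p ∘ sym)
    ... | no  y≉z = inj₁ (⊏⇒< (C⇒⊏ (C-swap p) (y≉z ∘ sym)) , ⊏⇒< (C⇒⊏ p y≉z))

    from : ∀ x y z → (y <′ x × z <′ x) ⊎ (y ≈ z × ¬ z ≈ x) → C x y z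
    from x y z (inj₂ (y≈z , z≉x)) = C-cong refl (sym y≈z) refl (C-distinct (z≉x ∘ sym))
    from x y z (inj₁ (y<x , z<x)) with em {P = y ≈ z}
    ... | yes y≈z = from x y z (inj₂ (y≈z , proj₂ z<x))
    -- By symmetry in y and z the smaller one can come first: then yz⁻¹ is negative, hence below the
    -- positive xz⁻¹.
    ... | no  y≉z with neg? (≉ y≉z)
    ... | inj₁ yz⁻¹- = ≺⇒C (neg⇒≺ yz⁻¹- (⊏⇒pos (<⇒⊏ z<x)))
    ... | inj₂ zy⁻¹- = C-swap (≺⇒C (neg⇒≺ (pos⇒⊏ zy⁻¹-) (⊏⇒pos (<⇒⊏ y<x))))

-- The induced C-relation on a subquotient.

module InducedCRelation (em : ∀ {a} → ExcludedMiddle a)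
  {c ℓ r a b d} {G : Group c ℓ} {C : Rel₃ (Group.Carrier G) r}
  (isC : IsCompatibleCRelation G C)
  {Γ : TotalOrder a b d} (V : Valuation G Γ) (γ : TotalOrder.Carrier Γ)
  (Gγ-≼ : ∀ {n x} → Subquotient._∈Gγ V γ n → ¬ Subquotient._∈Gγ V γ x →
          CRelation._≼_ em isC n x)
  where

  open IsCompatibleCRelation isC
  open CRelation em isC using (C⇒≺)

  private
    module Q where
      open Group (quotient V γ) public
      open GroupProperties (quotient V γ) public

    -- After translation by f′⁻¹ the relation would put an element outside G_γ strictly below one
    -- inside. Independence of representatives reduces to this.
    separates : ∀ {f f′ h} → f Q.≈ f′ → ¬ f Q.≈ h → ¬ C (proj₁ f) (proj₁ f′) (proj₁ h)
    separates {f} {f′} {h} f≈f′ f≉h p =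
      Gγ-≼ f≈f′ (λ h≈f′ → f≉h (Q.trans {f} {f′} {h} f≈f′ (Q.sym {h} {f′} h≈f′)))
        (C⇒≺ (C-swap p))

    Cγ = induced V γ C

    cong₁ : ∀ {f f′ g h} → f Q.≈ f′ → Cγ f g h → Cγ f′ g h
    cong₁ {f} {f′} {g} {h} f≈f′ (f≉h , p) =
      (λ f′≈h → f≉h (Q.trans {f} {f′} {h} f≈f′ f′≈h)) , Sum.map₂ step p
      where
      step : C (proj₁ f) (proj₁ g) (proj₁ h) → C (proj₁ f′) (proj₁ g) (proj₁ h)
      step q with C-cotrans (proj₁ f′) q
      ... | inj₁ q′ = q′
      ... | inj₂ q′ = contradiction q′ (separates {f} {f′} {h} f≈f′ f≉h)

    cong₂ : ∀ {f g g′ h} → g Q.≈ g′ → Cγ f g h → Cγ f g′ h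
    cong₂ {f} {g} {g′} {h} g≈g′ (f≉h , p) = f≉h , step p em
      where
      step : (g Q.≈ h ⊎ C (proj₁ f) (proj₁ g) (proj₁ h)) → Dec (g Q.≈ h) →
             g′ Q.≈ h ⊎ C (proj₁ f) (proj₁ g′) (proj₁ h)
      step _        (yes g≈h) = inj₁ (Q.trans {g′} {g} {h} (Q.sym {g} {g′} g≈g′) g≈h)
      step (inj₁ g≈h) (no g≉h) = contradiction g≈h g≉h
      step (inj₂ q) (no g≉h) with C-cotrans (proj₁ g′) q
      ... | inj₁ q′ = contradiction q′ (separates {g′} {g} {h} (Q.sym {g} {g′} g≈g′)
                        λ g′≈h → g≉h (Q.trans {g} {g′} {h} g≈g′ g′≈h))
      ... | inj₂ q′ = inj₂ q′

    Cγ-swap : ∀ {f g h} → Cγ f g h → Cγ f h g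
    Cγ-swap {f} {g} {h} (f≉h , p) = f≉g p em , Sum.map (Q.sym {g} {h}) C-swap p
      where
      f≉g : (g Q.≈ h ⊎ C (proj₁ f) (proj₁ g) (proj₁ h)) → Dec (g Q.≈ h) → ¬ f Q.≈ g
      f≉g _          (yes g≈h) f≈g = f≉h (Q.trans {f} {g} {h} f≈g g≈h)
      f≉g (inj₁ g≈h) (no g≉h)  _   = g≉h g≈h
      f≉g (inj₂ q)   (no _)    f≈g = separates {f} {g} {h} f≈g f≉h q

    Cγ-asym : ∀ {f g h} → Cγ f g h → ¬ Cγ g f h
    Cγ-asym (f≉h , _)      (_ , inj₁ f≈h)  = f≉h f≈h
    Cγ-asym (_ , inj₁ g≈h) (g≉h , _)       = g≉h g≈h
    Cγ-asym (_ , inj₂ p)   (_ , inj₂ q)    = C-asym p q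

    Cγ-cotrans : ∀ {f g h} w → Cγ f g h → Cγ w g h ⊎ Cγ f w h
    Cγ-cotrans {f} {g} {h} w (f≉h , p) with em {P = w Q.≈ h}
    ... | yes w≈h = inj₂ (f≉h , inj₁ w≈h)
    ... | no  w≉h with p
    ... | inj₁ g≈h = inj₁ (w≉h , inj₁ g≈h)
    ... | inj₂ q   = Sum.map (λ q′ → w≉h , inj₂ q′) (λ q′ → f≉h , inj₂ q′) (C-cotrans (proj₁ w) q)

    translate-cancel : ∀ {f h} u v → (v Q.∙ f Q.∙ u) Q.≈ (v Q.∙ h Q.∙ u) → f Q.≈ h
    translate-cancel {f} {h} u v p = Q.∙-cancelˡ v f h (Q.∙-cancelʳ u (v Q.∙ f) (v Q.∙ h) p)

    translate-cong : ∀ {f h} u v → f Q.≈ h → (v Q.∙ f Q.∙ u) Q.≈ (v Q.∙ h Q.∙ u)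
    translate-cong {f} {h} u v p = Q.∙-congʳ {u} {v Q.∙ f} {v Q.∙ h} (Q.∙-congˡ {v} {f} {h} p)

  isInducedCRelation : IsCompatibleCRelation (quotient V γ) (induced V γ C)
  isInducedCRelation = record
    { C-cong     = λ {x} {x′} {y} {y′} {z} {z′} x≈ y≈ z≈ p →
        -- The third argument is replaced by swapping it into second place and back.
        cong₂ {x′} {y} {y′} {z′} y≈ (Cγ-swap {x′} {z′} {y} (cong₂ {x′} {z} {z′} {y} z≈
          (Cγ-swap {x′} {y} {z} (cong₁ {x} {x′} {y} {z} x≈ p))))
    ; C-swap     = λ {x} {y} {z} → Cγ-swap {x} {y} {z}
    ; C-asym     = λ {x} {y} {z} → Cγ-asym {x} {y} {z}
    ; C-cotrans  = λ {x} {y} {z} → Cγ-cotrans {x} {y} {z}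
    ; C-distinct = λ {x} {y} x≉y → x≉y , inj₁ (Q.refl {y})
    ; compatible = λ {x} {y} {z} u v (x≉z , p) →
        (λ q → x≉z (translate-cancel {x} {z} u v q)) ,
        Sum.map (translate-cong {y} {z} u v) (compatible (proj₁ u) (proj₁ v)) p
    }

-- The cut valuation and its components.

module CutValuation (em : ∀ {a} → ExcludedMiddle a) {c ℓ r} (𝒢 : CGroup c ℓ r) where

  open CGroup 𝒢
  open GroupProperties group using (ε⁻¹≈ε; ⁻¹-involutive)
  open CRelation em isCompatibleCRelation
  open _⊴_ using (U-cut; S-cut)

  module V = PreorderValuation em ⊴-isValuationPreorder
  open V using (Γ; valuation; module Γ∞)

  module Component (γ : V.Γ.Carrier) where

    open Subquotient valuation γ using (_∈G^γ; _∈Gγ)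
    open TotalOrderProperties (Γ ∪∞) using (<-respˡ-≈)

    private
      g = proj₁ γ
      module Q where
        open Group (quotient valuation γ) public
        open GroupProperties (quotient valuation γ) public

    ∈G^γ⇒⊴ : ∀ {x} → x ∈G^γ → x ⊴ g
    ∈G^γ⇒⊴ p = V.≤⇒⊴ (Γ∞.trans (Γ∞.reflexive (Γ∞.Eq.sym (V.[γ]≈v γ))) p)

    ⊴⇒∈G^γ : ∀ {x} → x ⊴ g → x ∈G^γ
    ⊴⇒∈G^γ p = Γ∞.trans (Γ∞.reflexive (V.[γ]≈v γ)) (V.⊴⇒≤ p)

    ∈Gγ⇒⋬ : ∀ {x} → x ∈Gγ → ¬ g ⊴ x
    ∈Gγ⇒⋬ p = V.<⇒⋬ (<-respˡ-≈ (V.[γ]≈v γ) p)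

    ⋬⇒∈Gγ : ∀ {x} → ¬ g ⊴ x → x ∈Gγ
    ⋬⇒∈Gγ p = <-respˡ-≈ (Γ∞.Eq.sym (V.[γ]≈v γ)) (V.⋬⇒< p)

    isCγ : IsCompatibleCRelation (quotient valuation γ) (induced valuation γ C)
    isCγ = InducedCRelation.isInducedCRelation em isCompatibleCRelation valuation γ
      -- Here v(x) ≤ γ < v(n), so some cut separates n from x and n ≼ x.
      λ n∈ x∉ → ⋬⇒≼ λ x⊴n → ∈Gγ⇒⋬ n∈ (⊴-trans (dne (x∉ ∘ ⋬⇒∈Gγ)) x⊴n)

    private
      module Cγ = CRelation em isCγ

      x∙ε⁻¹≈x : ∀ x → x ∙ ε ⁻¹ ≈ x
      x∙ε⁻¹≈x x = trans (∙-congˡ (ε⁻¹≈ε)) (identityʳ x)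

      ≉ε⇒⊵ : ∀ x → ¬ x Q.≈ Q.ε → g ⊴ proj₁ x
      ≉ε⇒⊵ (x , _) x≉ε =
        ⊴-trans (dne (x≉ε ∘ ⋬⇒∈Gγ)) (⊴-reflexive (x∙ε⁻¹≈x x))

      ⊵⇒≉ε : ∀ x → g ⊴ proj₁ x → ¬ x Q.≈ Q.ε
      ⊵⇒≉ε (x , _) g⊴x x≈ε =
        ∈Gγ⇒⋬ x≈ε (⊴-trans g⊴x (⊴-reflexive (sym (x∙ε⁻¹≈x x))))

      -- The alternative x ∈ G_γ in C_γ is impossible since x⁻¹ ∉ G_γ. A negative class thus
      -- consists of negative elements of value γ.
      neg⁻ : ∀ x → Cγ.Neg x → g ⊴ proj₁ x × Neg (proj₁ x)
      neg⁻ x (x⁻¹≉ε , p) = ≉ε⇒⊵ x x≉ε , [ (λ x≈ε → contradiction x≈ε x≉ε) , id ]′ p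
        where
        x≉ε : ¬ x Q.≈ Q.ε
        x≉ε x≈ε = x⁻¹≉ε (Q.trans {x Q.⁻¹} {Q.ε Q.⁻¹} {Q.ε} (Q.⁻¹-cong {x} {Q.ε} x≈ε)
                    Q.ε⁻¹≈ε)

      neg⁺ : ∀ x → ¬ x Q.≈ Q.ε → Neg (proj₁ x) → Cγ.Neg x
      neg⁺ x x≉ε x- = Cγ.⁻¹-≉ε {x} x≉ε , inj₂ x-

    module _ {k} (k- : Neg k) (k⊴g : k ⊴ g) (g⊴k : g ⊴ k) where

      private
        ∈Uk : ∀ (x : Q.Carrier) → proj₁ x ∈U k
        ∈Uk (_ , x∈) = U-cut (⊴-trans (∈G^γ⇒⊴ x∈) g⊴k) k k- (neg⇒∈U k-)

        ∉Sk : ∀ {x} → g ⊴ x → ¬ x ∈S k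
        ∉Sk g⊴x x∈S = neg⇒∉S k- (S-cut (⊴-trans k⊴g g⊴x) k k- x∈S)

        -- As x ∈ U k, k ≺ x forces x⁻¹ ≼ k ≺ x. Otherwise x ≼ k, and x ∉ S k forces k ≺ x⁻¹.
        neg? : ∀ x → ¬ x Q.≈ Q.ε → Cγ.Neg x ⊎ Cγ.Neg (x Q.⁻¹)
        neg? x@(x′ , _) x≉ε with em {P = k ≺ x′}
        ... | yes k≺x = inj₂ (neg⁺ (x Q.⁻¹) (Cγ.⁻¹-≉ε {x} x≉ε)
                (≺-cong refl (sym (⁻¹-involutive _))
                  (≼-≺-trans (λ k≺x⁻¹ → ∈Uk x (k≺x , k≺x⁻¹)) k≺x)))
        ... | no x≼k = inj₁ (neg⁺ x x≉ε (≼-≺-trans x≼k (dne λ x⁻¹≼k →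
                ∉Sk (≉ε⇒⊵ x x≉ε) (x≼k , x⁻¹≼k))))

        -- A negative x in U k satisfies x ≼ k, so y ≺ x would give y ≺ k, hence y ∈ S k, and y
        -- would be trivial in the quotient.
        neg-≼ : ∀ x y → Cγ.Neg x → Cγ.Neg y → x Cγ.≼ y
        neg-≼ x y x- y- (x≉ε , inj₁ y≈ε) = ⊵⇒≉ε y (proj₁ (neg⁻ y y-)) y≈ε
        neg-≼ x y x- y- (x≉ε , inj₂ y≺x) =
          ∉Sk (proj₁ (neg⁻ y y-)) (≺⇒≼ y≺k , ≺⇒≼ (≺⇒⁻¹≺ (≺⇒≼ k-) y≺k))
          where
          x≼k : proj₁ x ≼ k
          x≼k k≺x = ∈Uk x (k≺x , ≺-trans k≺x (proj₂ (neg⁻ x x-)))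
          y≺k : proj₁ y ≺ k
          y≺k = ≺-≼-trans y≺x x≼k

      ~neg⇒orderType : OrderType (quotient valuation γ) (induced valuation γ C)
      ~neg⇒orderType = Cγ.orderType (λ {x} → neg? x) (λ {x} {y} → neg-≼ x y)

      ~neg⇒¬valuational : ¬ Valuational (quotient valuation γ) (induced valuation γ C)
      ~neg⇒¬valuational W = Cγ.≼-trans {k′ Q.⁻¹} {k′ Q.⁻¹ Q.⁻¹} {k′}
        (Cγ.valuational⇒≼⁻¹ W (k′ Q.⁻¹)) (Cγ.≼-reflexive {k′ Q.⁻¹ Q.⁻¹} {k′}
          (Q.⁻¹-involutive k′))
        (neg⁺ k′ (⊵⇒≉ε k′ g⊴k) k-)
        where
        k′ : Q.Carrier
        k′ = k , ⊴⇒∈G^γ k⊴g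

    elementary : ElementaryType (quotient valuation γ) (induced valuation γ C)
    elementary with em {P = Σ[ k ∈ Carrier ] Neg k × k ⊴ g × g ⊴ k}
    ... | yes (_ , k- , k⊴g , g⊴k) = inj₁ (~neg⇒orderType k- k⊴g g⊴k)
    ... | no  ¬k = inj₂ (Cγ.valuational ≼⁻¹)
      where
      ≼⁻¹ : ∀ x → x Cγ.≼ x Q.⁻¹
      ≼⁻¹ x p =
        let g⊴x⁻¹ , x⁻¹- = neg⁻ (x Q.⁻¹) (Cγ.≺-cong {x Q.⁻¹} {x Q.⁻¹} {x} {x Q.⁻¹ Q.⁻¹}
              (Q.refl {x Q.⁻¹}) (Q.sym {x Q.⁻¹ Q.⁻¹} {x} (Q.⁻¹-involutive x)) p)
        in ¬k (proj₁ x ⁻¹ , x⁻¹- , ∈G^γ⇒⊴ (proj₂ (x Q.⁻¹)) , g⊴x⁻¹)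

  between : ∀ γ δ → _<_ Γ γ δ →
    Valuational (quotient valuation γ) (induced valuation γ C) →
    Valuational (quotient valuation δ) (induced valuation δ C) →
    Σ[ α ∈ V.Γ.Carrier ]
      _<_ Γ γ α × _<_ Γ α δ × OrderType (quotient valuation α) (induced valuation α C)
  between γ δ (d⊴g , γ≉δ) Wγ Wδ =
    let (k , k- , d∈U , g∉S) = ⋬⇒separated (λ g⊴d → γ≉δ (g⊴d , d⊴g)) (lower (proj₂ δ))
        k⊴g = ∉S⇒⊵ k- g∉S
        d⊴k = ∈U⇒⊴ k- d∈U
        α   = k , lift (neg⇒≉ε k-)
    in α
     -- If v(k) were γ, k would be a negative element of G^γ / G_γ, which a valuational C_γ forbids;
     -- likewise for δ.
     , (k⊴g , λ (g⊴k , _) → Component.~neg⇒¬valuational γ k- k⊴g g⊴k Wγ)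
     , (d⊴k , λ (k⊴d , _) → Component.~neg⇒¬valuational δ k- k⊴d d⊴k Wδ)
     , Component.~neg⇒orderType α k- (⊴-reflexive refl) (⊴-reflexive refl)

theorem3p42 : (∀ {a} → ExcludedMiddle a) →
    ∀ {c ℓ r} (𝒢 : CGroup c ℓ r) →
    let open CGroup 𝒢 in
    Σ[ Γ ∈ TotalOrder (c ⊔ ℓ ⊔ r) (c ⊔ ℓ ⊔ r) (c ⊔ ℓ ⊔ r) ]
    Σ[ V ∈ Valuation group Γ ]
    Surjective _≈_ (TotalOrder._≈_ (Γ ∪∞)) (Valuation.v V)
    × (∀ γ → IsCompatibleCRelation (quotient V γ) (induced V γ C))
    × (∀ γ → ElementaryType (quotient V γ) (induced V γ C))
    × (∀ γ δ → _<_ Γ γ δ →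
    Valuational (quotient V γ) (induced V γ C) →
    Valuational (quotient V δ) (induced V δ C) →
    Σ[ α ∈ TotalOrder.Carrier Γ ]
    _<_ Γ γ α × _<_ Γ α δ × OrderType (quotient V α) (induced V α C))
theorem3p42 em 𝒢 =
  V.Γ , V.valuation , V.v-surjective , Component.isCγ , Component.elementary , between
  where open CutValuation em 𝒢
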